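{- There is an algorithm to decide, for an arbitrary given affine pair of communicating SR-machines, whether the protocol is (simultaneously) deadlock-free and has the bounded channel property.
   Context: A pair of communicating SR-machines is a CFSM protocol with communication graph having nodes $\{0,1\}$ and two edges $\alpha$ (from $0$ to $1$) and $\beta$ (from $1$ to $0$), disjoint finite message alphabets $M_\alpha,M_\beta$, and two finite state machines $F_j=(K_j,\Sigma_j,T_j,h_j)$, $j=0,1$, with $\Sigma_0=\{ -b:b\in M_\alpha\}\cup\{+b:b\in M_\beta\}$, $\Sigma_1=\{ -b:b\in M_\beta\}\cup\{+b:b\in M_\alpha\}$, $K_j$ finite, $h_j\in K_j$ initial, $T_j\subseteq K_j\times\Sigma_j\times K_j$ (transitions $p\xrightarrow{e}q$; $+b$ = receive, $-b$ = send; $p\xrightarrow{w}q$ means a directed path labelled $w$). A send state has no outgoing $+b$ transition, a receive state no outgoing $-b$ transition. $F_j$ is an SR-machine if every state is a send or a receive state, its transition diagram is strongly connected, and it is deterministic ($p\xrightarrow{e}q_1$, $p\xrightarrow{e}q_2$ imply $q_1=q_2$). Global states are $((p_0,p_1),(x_\alpha,x_\beta))$; initially $((h_0,h_1),(\lambda,\lambda))$. A step is a send (a machine performs $p\xrightarrow{ -b}q$ and $b$ is appended to its output channel: $\alpha$ for $F_0$, $\beta$ for $F_1$) or a receive (a machine performs $p\xrightarrow{+b}q$ and $b$ is removed from the front of its input channel, which must begin with $b$); the other machine is unchanged. A global state is deadlocked if both components are receive states and both channels are empty; deadlock-free means no reachable deadlocked global state. The bounded channel property means $|x_\alpha|+|x_\beta|$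 is bounded over all reachable global states. $\pi_\alpha(w)$ (resp. $\pi_\beta(w)$) is the string of $M_\alpha$- (resp. $M_\beta$-) symbols in $w$, in order, signs removed; $\mathbf Z_j=\{(\pi_\alpha(w),\pi_\beta(w)): h_j\xrightarrow{w}h_j\}$; the pair is affine if $\mathbf Z_0=\mathbf Z_1$. -}

module Defs where

open import Data.Fin using (Fin)
open import Data.List using (List; []; _∷_; _∷ʳ_; length)
open import Data.List.Membership.Propositional using (_∈_)
open import Data.Nat using (ℕ; _+_; _≤_)
open import Data.Product using (_×_; _,_; ∃-syntax)
open import Data.Sum using (_⊎_)
open import Level using (0ℓ)
open import Relation.Binary.Construct.Closure.ReflexiveTransitive using (Star)
open import Relation.Binary.PropositionalEquality using (_≡_)
open import Relation.Nullary using (¬_)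
open import Relation.Unary using (Pred; _≐_)

-- S is the alphabet of the machine's output channel, R that of its input
-- channel; `send b` is written -b and `receive b` is written +b on paper.
data Label (S R : Set) : Set where
  send    : S → Label S R
  receive : R → Label S R

record Machine (S R : Set) : Set where
  field
    size        : ℕ
    transitions : List (Fin size × Label S R × Fin size)
    initial     : Fin size

  State : Set
  State = Fin size

  infix 4 _-[_]→_ _-[_]→*_

  _-[_]→_ : State → Label S R → State → Set
  p -[ e ]→ q = (p , e , q) ∈ transitions

  data _-[_]→*_ : State → List (Label S R) → State → Set where
    []  : ∀ {p} → p -[ [] ]→* p
    _∷_ : ∀ {p q r e w} → p -[ e ]→ q → q -[ w ]→* r → p -[ e ∷ w ]→* r

  SendState : State → Set
  SendState p = ∀ b q → ¬ (p -[ receive b ]→ q)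

  ReceiveState : State → Set
  ReceiveState p = ∀ b q → ¬ (p -[ send b ]→ q)

  record IsSR : Set where
    field
      sendOrReceive     : ∀ p → SendState p ⊎ ReceiveState p
      stronglyConnected : ∀ p q → ∃[ w ] p -[ w ]→* q
      deterministic     : ∀ {p e q₁ q₂} → p -[ e ]→ q₁ → p -[ e ]→ q₂ → q₁ ≡ q₂

sent : ∀ {S R} → List (Label S R) → List S
sent []              = []
sent (send b ∷ w)    = b ∷ sent w
sent (receive _ ∷ w) = sent w

received : ∀ {S R} → List (Label S R) → List R
received []              = []
received (send _ ∷ w)    = received w
received (receive b ∷ w) = b ∷ received w

-- Disjointness of the alphabets Fin sizeα and Fin sizeβ is built in: in a label
-- their elements are told apart by the constructor, even when sizeα ≡ sizeβ.
record Protocol : Set where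
  field
    sizeα sizeβ : ℕ
    F₀ : Machine (Fin sizeα) (Fin sizeβ)
    F₁ : Machine (Fin sizeβ) (Fin sizeα)

  Mα Mβ : Set
  Mα = Fin sizeα
  Mβ = Fin sizeβ

  module F₀ = Machine F₀
  module F₁ = Machine F₁

module _ (P : Protocol) where
  open Protocol P

  record GlobalState : Set where
    constructor ⟨_,_∣_,_⟩
    field
      state₀ : F₀.State
      state₁ : F₁.State
      chanα  : List Mα
      chanβ  : List Mβ

  start : GlobalState
  start = ⟨ F₀.initial , F₁.initial ∣ [] , [] ⟩

  infix 4 _⟶_

  data _⟶_ : GlobalState → GlobalState → Set where
    send₀    : ∀ {p q r x y b} → p F₀.-[ send b ]→ q →
               ⟨ p , r ∣ x , y ⟩ ⟶ ⟨ q , r ∣ x ∷ʳ b , y ⟩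
    send₁    : ∀ {p q r x y b} → p F₁.-[ send b ]→ q →
               ⟨ r , p ∣ x , y ⟩ ⟶ ⟨ r , q ∣ x , y ∷ʳ b ⟩
    receive₀ : ∀ {p q r x y b} → p F₀.-[ receive b ]→ q →
               ⟨ p , r ∣ x , b ∷ y ⟩ ⟶ ⟨ q , r ∣ x , y ⟩
    receive₁ : ∀ {p q r x y b} → p F₁.-[ receive b ]→ q →
               ⟨ r , p ∣ b ∷ x , y ⟩ ⟶ ⟨ r , q ∣ x , y ⟩

  Reachable : GlobalState → Set
  Reachable g = Star _⟶_ start g

  Deadlocked : GlobalState → Set
  Deadlocked ⟨ p , q ∣ x , y ⟩ =
    F₀.ReceiveState p × F₁.ReceiveState q × x ≡ [] × y ≡ []

  DeadlockFree : Set
  DeadlockFree = ∀ g → Reachable g → ¬ Deadlocked g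

  BoundedChannel : Set
  BoundedChannel = ∃[ n ] ∀ g → Reachable g →
    length (GlobalState.chanα g) + length (GlobalState.chanβ g) ≤ n

  IsSRPair : Set
  IsSRPair = F₀.IsSR × F₁.IsSR

  -- The channel projections: F₀ sends on α and receives on β, F₁ conversely.
  Z₀ Z₁ : Pred (List Mα × List Mβ) 0ℓ
  Z₀ (x , y) = ∃[ w ] F₀.initial F₀.-[ w ]→* F₀.initial × sent w ≡ x × received w ≡ y
  Z₁ (x , y) = ∃[ w ] F₁.initial F₁.-[ w ]→* F₁.initial × received w ≡ x × sent w ≡ y

  Affine : Set
  Affine = Z₀ ≐ Z₁

{-# OPTIONS --safe #-}

-- Read F₀ and F₁ as deterministic two-tape automata over the tapes Mα*, Mβ*; being
-- affine means that they accept the same relation.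
--
-- Suppose that F₁ has a cycle of receptions at a state q.  An accepted pair of tapes
-- passing many times through that cycle is also read by F₀.  Run both machines on these
-- tapes, with F₁ halted at q.  If the protocol is deadlock-free, F₀ either fills the
-- channel α beyond any given bound, or waits for a message; in the latter case F₁ can
-- empty α along its cycle, which gives a deadlock.  Hence a reception cycle in either
-- machine refutes the conjunction of the two properties.
--
-- If F₁ has no such cycle, then α is bounded.  In a reachable state, rewind F₁ to the
-- moment when it had sent just what F₀ has received, and let F₀ return to its initial
-- state by a path of bounded length.  F₁ reads the same tapes, so it has to receive all of
-- α while sending only boundedly many messages, hence α is short.  Symmetrically for β,
-- and deadlock-freedom is then decided by exploring a finite state space.
module Submission where

open import Defs
open import Data.Empty using (⊥; ⊥-elim)
open import Data.Fin as Fin using (Fin; zero; suc)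
import Data.Fin.Properties as Fin
open import Data.List using (List; []; _∷_; [_]; _++_; _∷ʳ_; length; map; allFin; cartesianProductWith)
open import Data.List.Membership.Propositional using (_∈_; find)
open import Data.List.Membership.Propositional.Properties using (∈-allFin; ∈-cartesianProductWith⁺)
import Data.List.Membership.DecPropositional as DecMembership
open import Data.List.Properties using (++-assoc; ++-identityʳ; ∷-injective; ∷ʳ-++; length-++; ≡-dec)
open import Data.List.Relation.Unary.All as All using (All; []; _∷_)
open import Data.List.Relation.Unary.Any as Any using (here; there; any?)
open import Data.Nat using (ℕ; zero; suc; _+_; _*_; _≤_; _<_; z≤n; s≤s; s≤s⁻¹; _⊔_)
open import Data.Nat.Properties
open import Data.Product using (_×_; _,_; proj₁; proj₂; ∃-syntax)
import Data.Product.Properties as Prod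
open import Data.Sum using (_⊎_; inj₁; inj₂; map₂)
open import Function using (_∘_)
open import Relation.Binary.Construct.Closure.ReflexiveTransitive using (Star; ε; _◅_; _◅◅_; gmap)
open import Relation.Binary.Definitions using (Decidable; DecidableEquality)
open import Relation.Binary.PropositionalEquality using (_≡_; refl; sym; trans; cong; subst; module ≡-Reasoning)
open import Relation.Nullary using (Dec; yes; no; ¬_)
open import Relation.Nullary.Decidable using (map′; _×-dec_; _⊎-dec_; ¬?)
import Relation.Unary as Unary

open Machine using ([]; _∷_)

-- Projections of words, and auxiliary facts on lists and finite maxima.

sent-++ : ∀ {S R} (v w : List (Label S R)) → sent (v ++ w) ≡ sent v ++ sent w
sent-++ []              w = refl
sent-++ (send b ∷ v)    w = cong (b ∷_) (sent-++ v w)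
sent-++ (receive _ ∷ v) w = sent-++ v w

received-++ : ∀ {S R} (v w : List (Label S R)) → received (v ++ w) ≡ received v ++ received w
received-++ []              w = refl
received-++ (send _ ∷ v)    w = received-++ v w
received-++ (receive b ∷ v) w = cong (b ∷_) (received-++ v w)

received-receives : ∀ {S R} (v : List R) → received {S} (map receive v) ≡ v
received-receives []      = refl
received-receives (b ∷ v) = cong (b ∷_) (received-receives v)

label-≟ : ∀ {m n} → DecidableEquality (Label (Fin m) (Fin n))
label-≟ (send b)    (send c)    = map′ (cong send) (λ { refl → refl }) (b Fin.≟ c)
label-≟ (send _)    (receive _) = no λ ()
label-≟ (receive _) (send _)    = no λ ()
label-≟ (receive b) (receive c) = map′ (cong receive) (λ { refl → refl }) (b Fin.≟ c)

≡++-snoc : ∀ {A : Set} {s} (r x : List A) b → s ≡ r ++ x → s ++ b ∷ [] ≡ r ++ x ∷ʳ b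
≡++-snoc r x b refl = ++-assoc r x _

≡++-shift : ∀ {A : Set} {s : List A} r {x b} → s ≡ r ++ b ∷ x → s ≡ (r ++ b ∷ []) ++ x
≡++-shift r {x} {b} eq = trans eq (sym (++-assoc r (b ∷ []) x))

finite-bound : ∀ {n} (f : Fin n → ℕ) → ∃[ m ] (∀ i → f i ≤ m)
finite-bound {zero}  f = 0 , λ ()
finite-bound {suc n} f with finite-bound (f ∘ suc)
... | m , f≤m = f zero ⊔ m , λ where
  zero    → m≤m⊔n (f zero) m
  (suc i) → ≤-trans (f≤m i) (m≤n⊔m (f zero) m)

-- Paths, runs of receptions and determinacy within one machine.

module Paths {S R} (M : Machine S R) where
  open Machine M hiding ([]; _∷_)

  path-++ : ∀ {p q r v w} → p -[ v ]→* q → q -[ w ]→* r → p -[ v ++ w ]→* r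
  path-++ []      t = t
  path-++ (e ∷ s) t = e ∷ path-++ s t

  -- The path is cut right after the send that completes `v`. This is what rewinds a machine to an
  -- earlier moment of its output.
  split-at-sent : ∀ {p q w} v {y} → p -[ w ]→* q → sent w ≡ v ++ y →
                  ∃[ w₁ ] ∃[ w₂ ] ∃[ r ] p -[ w₁ ]→* r × w ≡ w₁ ++ w₂ × sent w₁ ≡ v
  split-at-sent []      s _ = [] , _ , _ , [] , refl , refl
  split-at-sent (c ∷ v) (_∷_ {e = send b} e s) eq with ∷-injective eq
  ... | refl , eq′ with split-at-sent v s eq′
  ... | w₁ , w₂ , r , s₁ , refl , refl = send b ∷ w₁ , w₂ , r , e ∷ s₁ , refl , refl
  split-at-sent (c ∷ v) (_∷_ {e = receive b} e s) eq with split-at-sent (c ∷ v) s eq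
  ... | w₁ , w₂ , r , s₁ , refl , eq₁ = receive b ∷ w₁ , w₂ , r , e ∷ s₁ , refl , eq₁

  -- Messages and end state are hidden, so that only the length matters and the existence of a run
  -- is decidable by recursion on it.
  data Receives : State → ℕ → Set where
    []  : ∀ {p} → Receives p 0
    _∷_ : ∀ {p q b n} → p -[ receive b ]→ q → Receives q n → Receives p (suc n)

  receives-pred : ∀ {p n} → Receives p (suc n) → Receives p n
  receives-pred (e ∷ [])      = []
  receives-pred (e ∷ (f ∷ r)) = e ∷ receives-pred (f ∷ r)

  receives-≤ : ∀ {p m n} → m ≤ n → Receives p n → Receives p m
  receives-≤ z≤n       _       = []
  receives-≤ (s≤s m≤n) (e ∷ r) = e ∷ receives-≤ m≤n r

  receives-path : ∀ {p n} → Receives p n →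
                  ∃[ v ] ∃[ q ] p -[ map receive v ]→* q × length v ≡ n
  receives-path []                 = [] , _ , [] , refl
  receives-path (_∷_ {b = b} e r) with receives-path r
  ... | v , q , s , eq = b ∷ v , q , e ∷ s , cong suc eq

  ReceiveStep : State → State → Set
  ReceiveStep p q = ∃[ b ] p -[ receive b ]→ q

  visit : ∀ {p n} → Receives p n → Fin (suc n) → State
  visit {p} _       zero    = p
  visit     (_ ∷ r) (suc i) = visit r i

  visit-reached : ∀ {p n} (r : Receives p n) i → Star ReceiveStep p (visit r i)
  visit-reached r       zero    = ε
  visit-reached (e ∷ r) (suc i) = (_ , e) ◅ visit-reached r i

  visit-cycle : ∀ {p n} (r : Receives p n) i j → i Fin.< j → visit r i ≡ visit r j →
                ∃[ q ] ∃[ q′ ] ReceiveStep q q′ × Star ReceiveStep q′ q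
  visit-cycle (e ∷ r) zero    (suc j) _   eq =
    _ , _ , (_ , e) , subst (Star ReceiveStep _) (sym eq) (visit-reached r j)
  visit-cycle (e ∷ r) (suc i) (suc j) i<j eq = visit-cycle r i j (s≤s⁻¹ i<j) eq

  -- Each step put in front would lengthen the run; `receives-pred` drops its last reception
  -- instead, so the length of the way from `p` to `q` never enters.
  receives-back : ∀ {p q n} → Star ReceiveStep p q → Receives q n → Receives p n
  receives-back ε             r = r
  receives-back ((_ , e) ◅ s) r = receives-pred (e ∷ receives-back s r)

  -- A run of `size` receptions visits `size + 1` states, so by the pigeonhole principle one of them
  -- repeats; from there the cycle can be traversed as often as desired.
  receives-forever : ∀ {p} → Receives p size → ∃[ q ] (∀ n → Receives q n)
  receives-forever r with Fin.pigeonhole (n<1+n size) (visit r)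
  ... | i , j , i<j , eq with visit-cycle r i j i<j eq
  ... | q , q′ , (_ , e) , back = q , loop
    where
    loop : ∀ n → Receives q n
    loop zero    = []
    loop (suc n) = e ∷ receives-back back (loop n)

  leading : List (Label S R) → ℕ
  leading []              = 0
  leading (send _ ∷ _)    = 0
  leading (receive _ ∷ w) = suc (leading w)

  leading-receives : ∀ {p q w} → p -[ w ]→* q → Receives p (leading w)
  leading-receives []                        = []
  leading-receives (_∷_ {e = send _} _ _)    = []
  leading-receives (_∷_ {e = receive _} e s) = e ∷ leading-receives s

  module _ {n} (¬receives : ∀ p → ¬ Receives p n) where

    leading-≤ : ∀ {p q w} → p -[ w ]→* q → leading w ≤ n
    leading-≤ {p} s = <⇒≤ (≰⇒> λ n≤ → ¬receives p (receives-≤ n≤ (leading-receives s)))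

    -- The receptions form blocks separated by the sends. The block in front of the first send is
    -- counted exactly, since it may still grow in the induction; every later block is charged at
    -- most `n` to the send before it.
    received-≤-leading : ∀ {p q w} → p -[ w ]→* q →
                         length (received w) ≤ leading w + length (sent w) * n
    received-≤-leading []                        = z≤n
    received-≤-leading (_∷_ {e = receive _} _ s) = s≤s (received-≤-leading s)
    -- The first block of `w` is now closed and charged to this send.
    received-≤-leading (_∷_ {e = send _} {w = w} _ s) =
      ≤-trans (received-≤-leading s) (+-monoˡ-≤ (length (sent w) * n) (leading-≤ s))

    received-≤ : ∀ {p q w} → p -[ w ]→* q → length (received w) ≤ suc (length (sent w)) * n
    received-≤ {w = w} s =
      ≤-trans (received-≤-leading s) (+-monoˡ-≤ (length (sent w) * n) (leading-≤ s))

  module SR (sr : IsSR) where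
    open IsSR sr

    receiving : ∀ {p b q} → p -[ receive b ]→ q → ReceiveState p
    receiving {p} e with sendOrReceive p
    ... | inj₁ ss = ⊥-elim (ss _ _ e)
    ... | inj₂ rs = rs

    ¬send×receive : ∀ {p b c q r} → p -[ send b ]→ q → ¬ p -[ receive c ]→ r
    ¬send×receive d e = receiving e _ _ d

    -- The state alone decides which tape is read next, and by determinism the next symbol on that
    -- tape decides the transition. Hence the path with the longer tapes begins with the other one,
    -- and `u` is its remainder.
    tapes-determine : ∀ {p q r v w s t} → p -[ v ]→* q → p -[ w ]→* r →
                      received w ≡ received v ++ s → sent w ≡ sent v ++ t →
                      ∃[ u ] q -[ u ]→* r × received u ≡ s × sent u ≡ t
    tapes-determine [] k eqr eqs = _ , k , eqr , eqs
    tapes-determine (_∷_ {e = send _} d j) (_∷_ {e = send _} e k) eqr eqs with ∷-injective eqs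
    ... | refl , eqs′ with deterministic d e
    ... | refl = tapes-determine j k eqr eqs′
    tapes-determine (_∷_ {e = receive _} d j) (_∷_ {e = receive _} e k) eqr eqs with ∷-injective eqr
    ... | refl , eqr′ with deterministic d e
    ... | refl = tapes-determine j k eqr′ eqs
    tapes-determine (_∷_ {e = send _} d j) (_∷_ {e = receive _} e k) _ _ =
      ⊥-elim (¬send×receive d e)
    tapes-determine (_∷_ {e = receive _} d j) (_∷_ {e = send _} e k) _ _ =
      ⊥-elim (¬send×receive e d)
    tapes-determine (_∷_ {e = send _} d j) [] _ ()
    tapes-determine (_∷_ {e = receive _} d j) [] ()

module FinitePaths {m n} (M : Machine (Fin m) (Fin n)) where
  open Machine M hiding ([]; _∷_)
  open Paths M

  step? : ∀ p e q → Dec (p -[ e ]→ q)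
  step? p e q = (p , e , q) ∈? transitions
    where open DecMembership (Prod.≡-dec Fin._≟_ (Prod.≡-dec label-≟ Fin._≟_)) using (_∈?_)

  receives? : ∀ k p → Dec (Receives p k)
  receives? zero    p = yes []
  receives? (suc k) p = map′ (λ { (_ , _ , e , r) → e ∷ r }) (λ { (e ∷ r) → _ , _ , e , r })
    (Fin.any? λ b → Fin.any? λ q → step? p (receive b) q ×-dec receives? k q)

  receiveState? : Unary.Decidable ReceiveState
  receiveState? p = Fin.all? λ b → Fin.all? λ q → ¬? (step? p (send b) q)

-- Reception cycles against deadlock-freedom and bounded channels.

module _ (P : Protocol) where
  open Protocol P
  private
    module P₀ = Paths F₀
    module P₁ = Paths F₁

  module _ (sr : IsSRPair P) where
    private
      module S₀ = P₀.SR (proj₁ sr)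
      module S₁ = P₁.SR (proj₂ sr)

    -- The word `w` is what `F₀` has not yet performed: either nothing is left, or `F₀` waits for a
    -- message on an empty channel.
    Halted₀ : F₀.State → List (Label Mα Mβ) → List Mβ → Set
    Halted₀ p w y = w ≡ [] ⊎ (F₀.ReceiveState p × y ≡ [])

    -- `F₀` moves whenever it can, and `F₁` only when `F₀` has finished or is waiting. The two
    -- equations are invariant: they ensure that each message at the front of a channel is the one
    -- the receiving path expects. Here `a` and `b` are the parts of the tapes that lie beyond the
    -- path of `F₁`.
    co-run : DeadlockFree P → ∀ {p p′ q q′ w₀ w₁ a b} x y → Reachable P ⟨ p , q ∣ x , y ⟩ →
             p F₀.-[ w₀ ]→* p′ → q F₁.-[ w₁ ]→* q′ →
             x ++ sent w₀ ≡ received w₁ ++ a → received w₀ ≡ y ++ sent w₁ ++ b →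
             ∃[ r ] ∃[ w ] ∃[ x′ ] ∃[ y′ ] Reachable P ⟨ r , q′ ∣ x′ , y′ ⟩ ×
               x′ ++ sent w ≡ a × Halted₀ r w y′
    co-run df x y g (_∷_ {e = send b} {w = w₀} d j) k eqα eqβ =
      co-run df (x ∷ʳ b) y (g ◅◅ send₀ d ◅ ε) j k (trans (∷ʳ-++ x b (sent w₀)) eqα) eqβ
    co-run df x (c ∷ y) g (_∷_ {e = receive b} d j) k eqα eqβ with ∷-injective eqβ
    ... | refl , eqβ′ = co-run df x y (g ◅◅ receive₀ d ◅ ε) j k eqα eqβ′
    co-run df x y g j@(_∷_ {e = receive _} _ _) (_∷_ {e = send c} {w = w₁} e k) eqα eqβ =
      co-run df x (y ∷ʳ c) (g ◅◅ send₁ e ◅ ε) j k eqα (trans eqβ (sym (∷ʳ-++ y c _)))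
    co-run df x y g [] (_∷_ {e = send c} e k) eqα eqβ =
      co-run df x (y ∷ʳ c) (g ◅◅ send₁ e ◅ ε) [] k eqα (trans eqβ (sym (∷ʳ-++ y c _)))
    co-run df (c ∷ x) y g j (_∷_ {e = receive b} e k) eqα eqβ with ∷-injective eqα
    ... | refl , eqα′ = co-run df x y (g ◅◅ receive₁ e ◅ ε) j k eqα′ eqβ
    -- Both machines wait on empty channels, which is a deadlock.
    co-run df [] [] g (_∷_ {e = receive _} d j) (_∷_ {e = receive _} e k) eqα eqβ =
      ⊥-elim (df _ g (S₀.receiving d , S₁.receiving e , refl , refl))
    -- `F₀` has nothing left to send and α is empty, so `eqα` fails.
    co-run df [] y g [] (_∷_ {e = receive _} e k) () eqβ
    co-run df x y g [] [] eqα eqβ = _ , [] , x , y , g , eqα , inj₁ refl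
    co-run df x [] g (_∷_ {e = receive b} {w = w₀} d j) [] eqα eqβ =
      _ , receive b ∷ w₀ , x , [] , g , eqα , inj₂ (S₀.receiving d , refl)

    -- The content of α is a proper prefix of `v`, so `F₁` can consume it along the given path, and
    -- a further reception follows: `F₁` stops in a receive state.
    drain : ∀ {p q q′ y s t} x v → q F₁.-[ map receive v ]→* q′ →
            x ++ s ≡ v ++ t → length x < length v →
            ∃[ r ] Star (_⟶_ P) ⟨ p , q ∣ x , y ⟩ ⟨ p , r ∣ [] , y ⟩ × F₁.ReceiveState r
    drain []      (c ∷ v) (e ∷ k) eq x<v = _ , ε , S₁.receiving e
    drain (b ∷ x) (c ∷ v) (e ∷ k) eq x<v with ∷-injective eq
    ... | refl , eq′ with drain x v k eq′ (s≤s⁻¹ x<v)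
    ... | r , steps , rs = r , receive₁ e ◅ steps , rs

    receive-cycle₁-refutes : Affine P → ∀ {q} → (∀ n → P₁.Receives q n) →
                             DeadlockFree P → ¬ BoundedChannel P
    receive-cycle₁-refutes (_ , Z₁⊆Z₀) {q} receives df (B , bounded)
      -- One reception more than the channel bound `B` permits α to hold.
      with v , q′ , k , |v|≡1+B ← P₁.receives-path (receives (suc B))
      with u , h→q ← F₁.IsSR.stronglyConnected (proj₂ sr) F₁.initial q
      with t , q′→h ← F₁.IsSR.stronglyConnected (proj₂ sr) q′ F₁.initial
      with w₀ , j , eqα , eqβ ← Z₁⊆Z₀ (_ , P₁.path-++ h→q (P₁.path-++ k q′→h) , refl , refl)
      -- `F₁` is given only the path to `q`; the receptions `v` and the return `t` make up the
      -- surplus `a`.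
      with co-run df [] [] ε j h→q (trans eqα (received-++ u _)) (trans eqβ (sent-++ u _))
    ... | r , w , x , y , g , eq , halted = halt halted
      where
      x-short : length x < length v
      x-short = subst (length x <_) (sym |v|≡1+B)
        (s≤s (≤-trans (m≤m+n (length x) (length y)) (bounded _ g)))

      eq′ : x ++ sent w ≡ v ++ received t
      eq′ = trans eq (trans (received-++ (map receive v) t) (cong (_++ received t) (received-receives v)))

      halt : Halted₀ r w y → ⊥
      -- `F₀` has finished, so α contains all of `v` and exceeds the bound.
      halt (inj₁ refl) = <⇒≱ x-short (begin
        length v                       ≤⟨ m≤m+n _ _ ⟩
        length v + length (received t) ≡⟨ length-++ v ⟨
        length (v ++ received t)       ≡⟨ cong length eq′ ⟨
        length (x ++ [])               ≡⟨ cong length (++-identityʳ x) ⟩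
        length x                       ∎)
        where open ≤-Reasoning
      -- `F₀` waits on an empty β; emptying α as well produces a deadlock.
      halt (inj₂ (rs , refl)) with drain x v k eq′ x-short
      ... | _ , steps , rs₁ = df _ (g ◅◅ steps) (rs , rs₁ , refl , refl)

  -- Histories of reachable states and the resulting channel bound.

  -- The interleaving of the run is forgotten; what survives is that each channel holds exactly what
  -- was sent and not yet received.
  record History (g : GlobalState P) : Set where
    constructor history
    open GlobalState g
    field
      {w₀}  : List (Label Mα Mβ)
      {w₁}  : List (Label Mβ Mα)
      path₀ : F₀.initial F₀.-[ w₀ ]→* state₀
      path₁ : F₁.initial F₁.-[ w₁ ]→* state₁
      α-eq  : sent w₀ ≡ received w₁ ++ chanα
      β-eq  : sent w₁ ≡ received w₀ ++ chanβ

  history-step : ∀ {g g′} → History g → _⟶_ P g g′ → History g′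
  history-step (history {w₀} {w₁} j k eqα eqβ) (send₀ {x = x} {y} {b} e) = history
    (P₀.path-++ j (e ∷ [])) k
    (trans (sent-++ w₀ [ send b ]) (≡++-snoc (received w₁) x b eqα))
    (trans eqβ (cong (_++ y) (sym (trans (received-++ w₀ [ send b ]) (++-identityʳ _)))))
  history-step (history {w₀} {w₁} j k eqα eqβ) (send₁ {x = x} {y} {b} e) = history
    j (P₁.path-++ k (e ∷ []))
    (trans eqα (cong (_++ x) (sym (trans (received-++ w₁ [ send b ]) (++-identityʳ _)))))
    (trans (sent-++ w₁ [ send b ]) (≡++-snoc (received w₀) y b eqβ))
  history-step (history {w₀} {w₁} j k eqα eqβ) (receive₀ {x = x} {y} {b} e) = history
    (P₀.path-++ j (e ∷ [])) k
    (trans (trans (sent-++ w₀ [ receive b ]) (++-identityʳ _)) eqα)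
    (trans (≡++-shift (received w₀) eqβ) (cong (_++ y) (sym (received-++ w₀ [ receive b ]))))
  history-step (history {w₀} {w₁} j k eqα eqβ) (receive₁ {x = x} {y} {b} e) = history
    j (P₁.path-++ k (e ∷ []))
    (trans (≡++-shift (received w₁) eqα) (cong (_++ x) (sym (received-++ w₁ [ receive b ]))))
    (trans (trans (sent-++ w₁ [ receive b ]) (++-identityʳ _)) eqβ)

  reachable-history : ∀ {g} → Reachable P g → History g
  reachable-history = go (history [] [] refl refl)
    where
    go : ∀ {g g′} → History g → Star (_⟶_ P) g g′ → History g′
    go h ε       = h
    go h (s ◅ t) = go (history-step h s) t

  module _ (sr₁ : F₁.IsSR) (Z₀⊆Z₁ : Z₀ P Unary.⊆ Z₁ P) (¬receives : ∀ q → ¬ P₁.Receives q F₁.size) where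
    open ≡-Reasoning
    private module B = ≤-Reasoning

    -- The closed path `w₀ ++ e` of `F₀` has a counterpart `w` in `F₁`, which begins with `v₁` by
    -- `tapes-determine`. The remainder `u` has to receive `x` among other things but sends only
    -- `received e`, so `received-≤` applies.
    chanα-≤ : ∀ {p q x y e} → History ⟨ p , q ∣ x , y ⟩ → p F₀.-[ e ]→* F₀.initial →
              length x ≤ suc (length (received e)) * F₁.size
    chanα-≤ {x = x} {e = e} (history {w₀} {w₁} j k eqα eqβ) p→h
      -- By `eqβ` the output of `F₁` begins with `received w₀`; after `v₁` exactly this has been
      -- sent.
      with v₁ , v₂ , _ , k₁ , refl , sent-v₁ ← P₁.split-at-sent (received w₀) k eqβ
      with w , l , received-w , sent-w ← Z₀⊆Z₁ (_ , P₀.path-++ j p→h , refl , refl)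
      with u , m , received-u , sent-u ← P₁.SR.tapes-determine sr₁
             {s = received v₂ ++ x ++ sent e} {t = received e} k₁ l
             (begin
               received w                                   ≡⟨ received-w ⟩
               sent (w₀ ++ e)                               ≡⟨ sent-++ w₀ e ⟩
               sent w₀ ++ sent e                            ≡⟨ cong (_++ sent e) eqα ⟩
               (received (v₁ ++ v₂) ++ x) ++ sent e         ≡⟨ ++-assoc (received (v₁ ++ v₂)) x _ ⟩
               received (v₁ ++ v₂) ++ x ++ sent e           ≡⟨ cong (_++ x ++ sent e) (received-++ v₁ v₂) ⟩
               (received v₁ ++ received v₂) ++ x ++ sent e  ≡⟨ ++-assoc (received v₁) (received v₂) _ ⟩
               received v₁ ++ received v₂ ++ x ++ sent e    ∎)
             (begin
               sent w                     ≡⟨ sent-w ⟩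
               received (w₀ ++ e)         ≡⟨ received-++ w₀ e ⟩
               received w₀ ++ received e  ≡⟨ cong (_++ received e) sent-v₁ ⟨
               sent v₁ ++ received e      ∎)
      = B.begin
        length x                                     B.≤⟨ m≤m+n _ _ ⟩
        length x + length (sent e)                   B.≡⟨ length-++ x ⟨
        length (x ++ sent e)                         B.≤⟨ m≤n+m _ _ ⟩
        length (received v₂) + length (x ++ sent e)  B.≡⟨ length-++ (received v₂) ⟨
        length (received v₂ ++ x ++ sent e)          B.≡⟨ cong length received-u ⟨
        length (received u)                          B.≤⟨ P₁.received-≤ ¬receives m ⟩
        suc (length (sent u)) * F₁.size              B.≡⟨ cong (λ s → suc (length s) * F₁.size) sent-u ⟩
        suc (length (received e)) * F₁.size          B.∎

  chanα-bounded : IsSRPair P → Affine P → (∀ q → ¬ P₁.Receives q F₁.size) →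
                  ∃[ n ] (∀ g → Reachable P g → length (GlobalState.chanα g) ≤ n)
  chanα-bounded (sr₀ , sr₁) (Z₀⊆Z₁ , _) ¬receives =
    suc (proj₁ bound) * F₁.size , λ g r → ≤-trans
      (chanα-≤ sr₁ Z₀⊆Z₁ ¬receives (reachable-history r) (proj₂ (home _)))
      (*-monoˡ-≤ F₁.size (s≤s (proj₂ bound (GlobalState.state₀ g))))
    where
    home : ∀ p → ∃[ w ] p F₀.-[ w ]→* F₀.initial
    home p = F₀.IsSR.stronglyConnected sr₀ p F₀.initial

    -- The way home depends only on the state of `F₀`, so one bound serves all global states.
    bound = finite-bound (λ p → length (received (proj₁ (home p))))

-- Symmetry between the two machines.

swap : Protocol → Protocol
swap P = record { sizeα = sizeβ ; sizeβ = sizeα ; F₀ = F₁ ; F₁ = F₀ }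
  where open Protocol P

module _ (P : Protocol) where

  swapState : GlobalState P → GlobalState (swap P)
  swapState ⟨ p , q ∣ x , y ⟩ = ⟨ q , p ∣ y , x ⟩

  swap-step : ∀ {g g′} → _⟶_ P g g′ → _⟶_ (swap P) (swapState g) (swapState g′)
  swap-step (send₀ e)    = send₁ e
  swap-step (send₁ e)    = send₀ e
  swap-step (receive₀ e) = receive₁ e
  swap-step (receive₁ e) = receive₀ e

  swap-reachable : ∀ {g} → Reachable P g → Reachable (swap P) (swapState g)
  swap-reachable = gmap swapState swap-step

  swap-affine : Affine P → Affine (swap P)
  swap-affine (Z₀⊆Z₁ , Z₁⊆Z₀) =
    (λ (w , k , r , s) → let (v , j , r′ , s′) = Z₁⊆Z₀ (w , k , s , r) in v , j , s′ , r′) ,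
    (λ (w , k , r , s) → let (v , j , r′ , s′) = Z₀⊆Z₁ (w , k , s , r) in v , j , s′ , r′)

module _ (P : Protocol) where

  swap-deadlockFree : DeadlockFree P → DeadlockFree (swap P)
  swap-deadlockFree df g r (rs₁ , rs₀ , y≡[] , x≡[]) =
    -- By eta for records `swap (swap P)` is `P` itself, so this is a run of `P`.
    df _ (swap-reachable (swap P) r) (rs₀ , rs₁ , x≡[] , y≡[])

  swap-boundedChannel : BoundedChannel P → BoundedChannel (swap P)
  swap-boundedChannel (n , bounded) = n , λ where
    ⟨ _ , _ ∣ x , y ⟩ r →
      subst (_≤ n) (+-comm (length y) (length x)) (bounded _ (swap-reachable (swap P) r))

-- Exploration of a finite transition system.

remove : ∀ {A : Set} {x} {xs : List A} → x ∈ xs →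
         ∃[ ys ] length xs ≡ suc (length ys) × (∀ {z} → z ∈ xs → z ≡ x ⊎ z ∈ ys)
remove {xs = x ∷ xs} (here refl) = xs , refl , λ where
  (here z≡x) → inj₁ z≡x
  (there z∈) → inj₂ z∈
remove {xs = y ∷ xs} (there x∈) with remove x∈
... | ys , eq , f = y ∷ ys , cong suc eq , λ where
  (here z≡y) → inj₂ (here z≡y)
  (there z∈) → map₂ there (f z∈)

module _ {A : Set} {_⟶′_ : A → A → Set} (_⟶?_ : Decidable _⟶′_) (s : A) where

  private
    Reached : A → Set
    Reached = Star _⟶′_ s

  record Explored : Set where
    field
      states   : List A
      sound    : All Reached states
      complete : ∀ {x} → Reached x → x ∈ states

  -- The invariant is that `seen` holds reachable elements only and that `seen` and `rest` together
  -- cover all of them. An element of `rest` one step away from `seen` is moved over, which shortens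
  -- `rest`; when there is none, `seen` is closed under steps.
  explore : ∀ n (seen rest : List A) → length rest ≡ n → s ∈ seen → All Reached seen →
            (∀ {x} → Reached x → x ∈ seen ⊎ x ∈ rest) → Explored
  explore n seen rest len s∈ sound cover
    with any? (λ y → any? (λ x → x ⟶? y) seen) rest
  ... | no none = record { states = seen ; sound = sound ; complete = go ε s∈ }
    where
    go : ∀ {x y} → Reached x → x ∈ seen → Star _⟶′_ x y → y ∈ seen
    go r x∈ ε       = x∈
    go r x∈ (e ◅ t) with cover (r ◅◅ e ◅ ε)
    ... | inj₁ y∈ = go (r ◅◅ e ◅ ε) y∈ t
    ... | inj₂ y∈ = ⊥-elim (none (Any.map (λ { refl → Any.map (λ { refl → e }) x∈ }) y∈))
  explore n seen rest len s∈ sound cover | yes found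
    with y , y∈ , step ← find found
    with x , x∈ , e ← find step
    with rest′ , len′ , split ← remove y∈
    with n
  ... | zero  = ⊥-elim (0≢1+n (trans (sym len) len′))
  ... | suc m = explore m (y ∷ seen) rest′ (suc-injective (trans (sym len′) len)) (there s∈)
    ((All.lookup sound x∈ ◅◅ e ◅ ε) ∷ sound) cover′
    where
    cover′ : ∀ {z} → Reached z → z ∈ y ∷ seen ⊎ z ∈ rest′
    cover′ r with cover r
    ... | inj₁ z∈ = inj₁ (there z∈)
    ... | inj₂ z∈ with split z∈
    ... | inj₁ z≡y = inj₁ (here z≡y)
    ... | inj₂ z∈′ = inj₂ z∈′

  reachable-all? : ∀ {Q : A → Set} → Unary.Decidable Q → (universe : List A) →
                   (∀ {x} → Reached x → x ∈ universe) → Dec (∀ x → Reached x → Q x)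
  reachable-all? Q? universe cover = map′
    (λ all x r → All.lookup all (complete r))
    (λ f → All.map (λ {x} r → f x r) sound)
    (All.all? Q? states)
    where
    open Explored (explore (length universe) (s ∷ []) universe refl (here refl) (ε ∷ [])
                    (inj₂ ∘ cover))

-- Deciding deadlock-freedom when the channels are bounded.

words : ∀ k → ℕ → List (List (Fin k))
words k zero    = [] ∷ []
-- The empty word recurs at every level because all lengths up to the bound are listed.
words k (suc n) = [] ∷ cartesianProductWith _∷_ (allFin k) (words k n)

∈-words : ∀ {k n} (x : List (Fin k)) → length x ≤ n → x ∈ words k n
∈-words {n = zero}  []      _   = here refl
∈-words {n = suc n} []      _   = here refl
∈-words {n = suc n} (b ∷ x) x≤n =
  there (∈-cartesianProductWith⁺ _∷_ (∈-allFin b) (∈-words x (s≤s⁻¹ x≤n)))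

module _ (P : Protocol) where
  open Protocol P
  private
    module D₀ = FinitePaths F₀
    module D₁ = FinitePaths F₁

  _⟶?_ : Decidable (_⟶_ P)
  ⟨ p , q ∣ x , y ⟩ ⟶? ⟨ p′ , q′ ∣ x′ , y′ ⟩ = map′ to from
    ((Fin.any? λ b → D₀.step? p (send b) p′ ×-dec (q′ Fin.≟ q ×-dec (x′ ≟α (x ∷ʳ b)) ×-dec (y′ ≟β y))) ⊎-dec
     (Fin.any? λ b → D₁.step? q (send b) q′ ×-dec (p′ Fin.≟ p ×-dec (x′ ≟α x) ×-dec (y′ ≟β (y ∷ʳ b)))) ⊎-dec
     (Fin.any? λ b → D₀.step? p (receive b) p′ ×-dec (q′ Fin.≟ q ×-dec (x′ ≟α x) ×-dec (y ≟β (b ∷ y′)))) ⊎-dec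
     (Fin.any? λ b → D₁.step? q (receive b) q′ ×-dec (p′ Fin.≟ p ×-dec (x ≟α (b ∷ x′)) ×-dec (y′ ≟β y))))
    where
    _≟α_ = ≡-dec (Fin._≟_ {sizeα})
    _≟β_ = ≡-dec (Fin._≟_ {sizeβ})

    to = λ where
      (inj₁ (_ , e , refl , refl , refl))               → send₀ e
      (inj₂ (inj₁ (_ , e , refl , refl , refl)))        → send₁ e
      (inj₂ (inj₂ (inj₁ (_ , e , refl , refl , refl)))) → receive₀ e
      (inj₂ (inj₂ (inj₂ (_ , e , refl , refl , refl)))) → receive₁ e

    from = λ where
      (send₀ e)    → inj₁ (_ , e , refl , refl , refl)
      (send₁ e)    → inj₂ (inj₁ (_ , e , refl , refl , refl))
      (receive₀ e) → inj₂ (inj₂ (inj₁ (_ , e , refl , refl , refl)))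
      (receive₁ e) → inj₂ (inj₂ (inj₂ (_ , e , refl , refl , refl)))

  deadlocked? : Unary.Decidable (Deadlocked P)
  deadlocked? ⟨ p , q ∣ x , y ⟩ =
    D₀.receiveState? p ×-dec D₁.receiveState? q ×-dec ≡-dec Fin._≟_ x [] ×-dec ≡-dec Fin._≟_ y []

  -- Each channel is bounded by `n` separately, which covers all states of total channel length at
  -- most `n`.
  globalStates : ℕ → List (GlobalState P)
  globalStates n = cartesianProductWith (λ (p , q) (x , y) → ⟨ p , q ∣ x , y ⟩)
    (cartesianProductWith _,_ (allFin F₀.size) (allFin F₁.size))
    (cartesianProductWith _,_ (words sizeα n) (words sizeβ n))

  ∈-globalStates : ∀ {n} (g : GlobalState P) →
                   length (GlobalState.chanα g) + length (GlobalState.chanβ g) ≤ n →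
                   g ∈ globalStates n
  ∈-globalStates ⟨ p , q ∣ x , y ⟩ x+y≤n =
    ∈-cartesianProductWith⁺ (λ (p , q) (x , y) → ⟨ p , q ∣ x , y ⟩)
      (∈-cartesianProductWith⁺ _,_ (∈-allFin p) (∈-allFin q))
      (∈-cartesianProductWith⁺ _,_
        (∈-words x (m+n≤o⇒m≤o (length x) x+y≤n))
        (∈-words y (m+n≤o⇒n≤o (length x) x+y≤n)))

  deadlockFree? : BoundedChannel P → Dec (DeadlockFree P)
  deadlockFree? (n , bounded) =
    reachable-all? _⟶?_ (start P) (λ g → ¬? (deadlocked? g)) (globalStates n)
      (λ r → ∈-globalStates _ (bounded _ r))

theorem6p4 : (P : Protocol) → IsSRPair P → Affine P → Dec (DeadlockFree P × BoundedChannel P)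
theorem6p4 P sr@(sr₀ , sr₁) aff
  -- A machine has a reception cycle exactly when it admits a run of `size` receptions, and this is
  -- decidable.
  with Fin.any? (FinitePaths.receives? F₁ F₁.size) | Fin.any? (FinitePaths.receives? F₀ F₀.size)
  where open Protocol P
... | yes (_ , r) | _ = no λ (df , bd) →
      receive-cycle₁-refutes P sr aff (proj₂ (Paths.receives-forever F₁ r)) df bd
  where open Protocol P
... | no _ | yes (_ , r) = no λ (df , bd) →
      receive-cycle₁-refutes (swap P) (sr₁ , sr₀) (swap-affine P aff)
        (proj₂ (Paths.receives-forever F₀ r)) (swap-deadlockFree P df) (swap-boundedChannel P bd)
  where open Protocol P
... | no ¬r₁ | no ¬r₀
  with m , α≤m ← chanα-bounded P sr aff (λ q r → ¬r₁ (q , r))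
  with n , β≤n ← chanα-bounded (swap P) (sr₁ , sr₀) (swap-affine P aff) (λ q r → ¬r₀ (q , r))
  -- The bounded channel property holds outright here, so only deadlock-freedom remains to be
  -- decided.
  = map′ (_, bounded) proj₁ (deadlockFree? P bounded)
  where
  bounded : BoundedChannel P
  bounded = m + n , λ g r → +-mono-≤ (α≤m g r) (β≤n _ (swap-reachable P r))
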